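{- Let $k\ge 1$ be an integer, let $G=(V,E)$ be a finite simple undirected $k$-edge-connected graph, let $e=\{u,v\}\in E$, let $G'=G\setminus\{e\}$, and suppose $\lambda(G')<k$. Let $G''$ be the augmented graph produced from $G'$ by the procedure HandleDeletion$(e)$ (described in the context). Then $\lambda(G'')\ge k$ and $|E(G'')\setminus E(G')|\le 2$.
   Context: All graphs are finite, simple, undirected and unweighted. $\lambda(x,y;H)$ is the maximum number of pairwise edge-disjoint $x$–$y$ paths in $H$, and $\lambda(H)=\min_{x\ne y}\lambda(x,y;H)$ is the global edge-connectivity; $H$ is $k$-edge-connected if $\lambda(H)\ge k$. $H\cup\{e\}$ and $H\setminus\{e\}$ denote the graphs resulting from insertion and deletion of the edge $e$. **Flow network.** Each undirected edge $\{x,y\}$ of $G'$ is modelled by the two arcs $(x,y)$ and $(y,x)$, each of capacity $1$. Let $f$ be a maximum $u$–$v$ flow in $G'$, computed by Dinic's algorithm. In the residual graph $G_f$, a saturated arc $(x,y)$ with $f(x,y)=1$ is replaced by a backward arc $(y,x)$ of residual capacity $2$, while an edge carrying no flow keeps both arcs with residual capacity $1$. **HandleDeletion$(e)$**, for $e=\{u,v\}$. Delete $e$ to obtain $G'$ and compute a maximum $u$–$v$ flow $f$ in $G'$. If its value is at least $k$, nothing more is done. If its value is $k-1$, compute $S=\{w\in V: w\text{ is reachable from }u\text{ in }G_f\}$ and $T=\{w\in V: v\text{ is reachable from }w\text{ in }G_f\}$. - If $|S|\ge2$ or $|T|\ge2$: choose arbitrarily $u'\in S$ and $v'\in T$ with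 $\{u',v'\}\ne\{u,v\}$ and add the edge $\{u',v'\}$, giving $G''=G'\cup\{\{u',v'\}\}$. - If $S=\{u\}$ and $T=\{v\}$: choose an arbitrary $w\in V\setminus\{u,v\}$ and add the two edges $\{u,w\}$ and $\{w,v\}$, giving $G''=G'\cup\{\{u,w\},\{w,v\}\}$.
   Formalization: Each edge added by HandleDeletion is required to be new (distinct endpoints not already adjacent); without this the claim fails, e.g. k=2 and G a triangle, where the only choice of w re-adds existing edges and G''=G'. -}

module Defs where

open import Algebra.Properties.CommutativeMonoid.Sum using (sum-syntax)
open import Data.Empty using (⊥-elim)
open import Data.Fin using (Fin; _<_)
open import Data.Fin.Properties using (_≟_; _<?_)
open import Data.Fin.Subset using (Subset; _∈_; ⁅_⁆; ∣_∣)
open import Data.Integer using (ℤ; +_; _⊖_; 1ℤ) renaming (_≤_ to _≤ℤ_; _-_ to _-ℤ_)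
open import Data.List using (List; []; _∷_; filter; cartesianProduct; allFin)
import Data.List.Membership.Propositional as List
import Data.List.Membership.DecPropositional as DecMembership
open import Data.List.Relation.Unary.Unique.Propositional using (Unique)
open import Data.Nat using (ℕ; _+_; _∸_; _≤_) renaming (_<_ to _<ℕ_)
open import Data.Nat.Properties using (+-0-commutativeMonoid)
open import Data.Product using (Σ-syntax; ∃-syntax; _×_; _,_; proj₁; proj₂)
open import Data.Product.Properties using (≡-dec)
open import Data.Sum using (_⊎_; inj₁; inj₂)
open import Function using (_⇔_)
open import Level using (0ℓ)
open import Relation.Binary using (Rel; Decidable; Symmetric; Irreflexive)
open import Relation.Binary.Construct.Closure.ReflexiveTransitive using (Star; ε; _◅_)
open import Relation.Binary.PropositionalEquality using (_≡_; _≢_; refl; sym; trans)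
open import Relation.Nullary using (¬_; Dec; yes; no)
open import Relation.Nullary.Decidable using (_×-dec_; _⊎-dec_; ¬?)

private
  variable
    n : ℕ

record Graph (n : ℕ) : Set₁ where
  field
    Adj        : Rel (Fin n) 0ℓ
    Adj?       : Decidable Adj
    Adj-sym    : Symmetric Adj
    Adj-irrefl : Irreflexive _≡_ Adj

open Graph public

-- {a , b} = {x , y} as unordered pairs.
SameEdge : Fin n × Fin n → Fin n × Fin n → Set
SameEdge (a , b) (x , y) = (a ≡ x × b ≡ y) ⊎ (a ≡ y × b ≡ x)

sameEdge? : Decidable (SameEdge {n})
sameEdge? (a , b) (x , y) = ((a ≟ x) ×-dec (b ≟ y)) ⊎-dec ((a ≟ y) ×-dec (b ≟ x))

sameEdge-swap : {a b : Fin n} {e : Fin n × Fin n} → SameEdge (a , b) e → SameEdge (b , a) e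
sameEdge-swap (inj₁ (p , q)) = inj₂ (q , p)
sameEdge-swap (inj₂ (p , q)) = inj₁ (q , p)

-- One ordered pair (x , y) with x < y for each edge {x , y}.
E : Graph n → List (Fin n × Fin n)
E {n} H = filter (λ e → (proj₁ e <? proj₂ e) ×-dec Adj? H (proj₁ e) (proj₂ e))
                 (cartesianProduct (allFin n) (allFin n))

infixl 6 _∖_

_∖_ : List (Fin n × Fin n) → List (Fin n × Fin n) → List (Fin n × Fin n)
es ∖ es′ = filter (λ e → ¬? (e ∈? es′)) es
  where open DecMembership (≡-dec _≟_ _≟_) using (_∈?_)

delete : (H : Graph n) (x y : Fin n) → Graph n
delete H x y = record
  { Adj        = λ a b → Adj H a b × ¬ SameEdge (a , b) (x , y)
  ; Adj?       = λ a b → Adj? H a b ×-dec ¬? (sameEdge? (a , b) (x , y))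
  ; Adj-sym    = λ (ab , a≠) → Adj-sym H ab , λ s → a≠ (sameEdge-swap s)
  ; Adj-irrefl = λ a≡b (ab , _) → Adj-irrefl H a≡b ab
  }

NonEdge : Graph n → Fin n → Fin n → Set
NonEdge H x y = x ≢ y × ¬ Adj H x y

-- Graphs being simple, an edge {x , y} can be inserted only when x and y are
-- distinct and not yet adjacent: there are neither loops nor parallel edges.
insert : (H : Graph n) (x y : Fin n) → NonEdge H x y → Graph n
insert H x y (x≢y , _) = record
  { Adj        = λ a b → Adj H a b ⊎ SameEdge (a , b) (x , y)
  ; Adj?       = λ a b → Adj? H a b ⊎-dec sameEdge? (a , b) (x , y)
  ; Adj-sym    = λ { (inj₁ ab) → inj₁ (Adj-sym H ab)
                   ; (inj₂ s)  → inj₂ (sameEdge-swap s) }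
  ; Adj-irrefl = λ { a≡b (inj₁ ab) → Adj-irrefl H a≡b ab
                   ; refl (inj₂ (inj₁ (p , q))) → x≢y (trans (sym p) q)
                   ; refl (inj₂ (inj₂ (p , q))) → x≢y (trans (sym q) p) }
  }

module _ {H : Graph n} where

  vertices : ∀ {x y} → Star (Adj H) x y → List (Fin n)
  vertices {x} ε       = x ∷ []
  vertices {x} (_ ◅ w) = x ∷ vertices w

  edges : ∀ {x y} → Star (Adj H) x y → List (Fin n × Fin n)
  edges ε                   = []
  edges (_◅_ {x} {y} _ w) = (x , y) ∷ edges w

record Path (H : Graph n) (x y : Fin n) : Set where
  field
    walk   : Star (Adj H) x y
    simple : Unique (vertices {H = H} walk)

open Path public

EdgeDisjoint : {H : Graph n} {x y : Fin n} → Path H x y → Path H x y → Set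
EdgeDisjoint {H = H} p q =
  ∀ {d e} → d List.∈ edges {H = H} (walk p) → e List.∈ edges {H = H} (walk q) → ¬ SameEdge d e

EdgeDisjointPaths : Graph n → Fin n → Fin n → ℕ → Set
EdgeDisjointPaths H x y m =
  Σ[ p ∈ (Fin m → Path H x y) ] (∀ i j → i ≢ j → EdgeDisjoint (p i) (p j))

-- λ(x , y ; H) = m
IsLocalConnectivity : Graph n → Fin n → Fin n → ℕ → Set
IsLocalConnectivity H x y m =
  EdgeDisjointPaths H x y m × (∀ m′ → EdgeDisjointPaths H x y m′ → m′ ≤ m)

-- λ(H) = ℓ
IsEdgeConnectivity : Graph n → ℕ → Set
IsEdgeConnectivity H ℓ =
  (∃[ x ] ∃[ y ] (x ≢ y × IsLocalConnectivity H x y ℓ)) ×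
  (∀ x y m → x ≢ y → IsLocalConnectivity H x y m → ℓ ≤ m)

EdgeConnected : ℕ → Graph n → Set
EdgeConnected k H = ∃[ ℓ ] (IsEdgeConnectivity H ℓ × k ≤ ℓ)

capacity : Graph n → Fin n → Fin n → ℕ
capacity H x y with Adj? H x y
... | yes _ = 1
... | no  _ = 0

outflow inflow : (Fin n → Fin n → ℕ) → Fin n → ℕ
outflow {n} f x = sum-syntax +-0-commutativeMonoid n (λ y → f x y)
inflow  {n} f x = sum-syntax +-0-commutativeMonoid n (λ y → f y x)

record IsFlow (H : Graph n) (u v : Fin n) (f : Fin n → Fin n → ℕ) : Set where
  field
    bounded   : ∀ x y → f x y ≤ capacity H x y
    conserved : ∀ x → x ≢ u → x ≢ v → outflow f x ≡ inflow f x

value : (Fin n → Fin n → ℕ) → Fin n → ℤ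
value f u = outflow f u ⊖ inflow f u

-- Integral flows suffice: capacities are integral and the flow is one computed
-- by augmenting paths.
IsMaxFlow : Graph n → Fin n → Fin n → (Fin n → Fin n → ℕ) → Set
IsMaxFlow H u v f = IsFlow H u v f × (∀ g → IsFlow H u v g → value g u ≤ℤ value f u)

-- On an edge {x , y} with f x y = 1 and f y x = 0 this gives 0 for (x , y) and 2
-- for (y , x); on an edge without flow it gives 1 for both arcs.  The
-- subtraction does not truncate when f is a flow.
residual : Graph n → (Fin n → Fin n → ℕ) → Fin n → Fin n → ℕ
residual H f x y = (capacity H x y ∸ f x y) + f y x

ResidualArc : Graph n → (Fin n → Fin n → ℕ) → Rel (Fin n) 0ℓ
ResidualArc H f x y = 0 <ℕ residual H f x y

IsSourceSide : Graph n → (Fin n → Fin n → ℕ) → Fin n → Subset n → Set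
IsSourceSide H f u S = ∀ w → (w ∈ S) ⇔ Star (ResidualArc H f) u w

IsSinkSide : Graph n → (Fin n → Fin n → ℕ) → Fin n → Subset n → Set
IsSinkSide H f v T = ∀ w → (w ∈ T) ⇔ Star (ResidualArc H f) w v

-- HandleDeletion k G u v G″: some run of the procedure on the edge {u , v} of G,
-- for some maximum flow and some outcome of the arbitrary choices, yields G″.
data HandleDeletion (k : ℕ) (G : Graph n) (u v : Fin n) : Graph n → Set₁ where

  unchanged :
    ∀ f → IsMaxFlow (delete G u v) u v f → + k ≤ℤ value f u →
    HandleDeletion k G u v (delete G u v)

  addOne :
    ∀ f → IsMaxFlow (delete G u v) u v f → value f u ≡ + k -ℤ 1ℤ →
    ∀ S → IsSourceSide (delete G u v) f u S →
    ∀ T → IsSinkSide (delete G u v) f v T →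
    2 ≤ ∣ S ∣ ⊎ 2 ≤ ∣ T ∣ →
    ∀ u′ v′ → u′ ∈ S → v′ ∈ T → ¬ SameEdge (u′ , v′) (u , v) →
    (new : NonEdge (delete G u v) u′ v′) →
    HandleDeletion k G u v (insert (delete G u v) u′ v′ new)

  addTwo :
    ∀ f → IsMaxFlow (delete G u v) u v f → value f u ≡ + k -ℤ 1ℤ →
    ∀ S → IsSourceSide (delete G u v) f u S →
    ∀ T → IsSinkSide (delete G u v) f v T →
    S ≡ ⁅ u ⁆ → T ≡ ⁅ v ⁆ →
    ∀ w → w ≢ u → w ≢ v →
    (new₁ : NonEdge (delete G u v) u w) →
    (new₂ : NonEdge (insert (delete G u v) u w new₁) w v) →
    HandleDeletion k G u v (insert (insert (delete G u v) u w new₁) w v new₂)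

{-# OPTIONS --safe #-}

-- By Menger's theorem λ(H) ≥ k means that every cut of H has at least k edges.
-- Deleting {u , v} costs one edge in each cut separating u from v and nothing in
-- the others, so every deficient cut X of G′ (u ∈ X, v ∉ X) has exactly k - 1 edges.
-- A flow of value k - 1 saturates such an X: no residual arc leaves it, so S ⊆ X and
-- T ∩ X = ∅, and an edge from S to T crosses X.  With two edges {u , w} and {w , v},
-- one of them crosses X wherever w lies.
--
-- Menger's theorem is obtained from integral skew-symmetric flows g a b = - g b a,
-- for which an augmentation is the addition of the unit flow along a simple path and
-- extracting a path is its subtraction.

module Submission where

open import Defs
open import Data.Bool using (if_then_else_)
open import Data.Fin using (Fin)
open import Data.Fin.Properties using (_≟_; any?)
import Data.Fin as Fin
import Data.Fin.Properties as Finₚ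
open import Data.Fin.Subset using (Subset; _∈_; _∉_; ∁; ⁅_⁆; _∪_; _⊂_)
open import Data.Fin.Subset.Properties
  using (_∈?_; x∈p⇒x∉∁p; x∈∁p⇒x∉p; x∉p⇒x∈∁p; x∉∁p⇒x∈p; x∈⁅x⁆; x∈⁅y⁆⇒x≡y; x∈p∪q⁻; p⊆p∪q; q⊆p∪q)
open import Data.Fin.Subset.Induction using (⊃-wellFounded; Acc; acc)
open import Data.Integer
  using (ℤ; +_; -[1+_]; +[1+_]; 0ℤ; 1ℤ; -1ℤ; _+_; _*_; -_; _-_; ∣_∣; +≤+; -≤+; +<+; -<+)
  renaming (_≤_ to _≤ℤ_; _<_ to _<ℤ_; _≤?_ to _≤ℤ?_; _<?_ to _<ℤ?_)
import Data.Integer.Properties as ℤ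
open import Data.Integer.Tactic.RingSolver using (solve-∀)
open import Data.List using (List; []; _∷_; length; filter; cartesianProduct; allFin)
open import Data.List.Extrema.Nat using (argmin; argmin-all; f[argmin]≤f[xs])
import Data.List.Membership.DecPropositional as DecMembership
import Data.List.Membership.Propositional as List
open import Data.List.Membership.Propositional.Properties
  using (∈-filter⁺; ∈-filter⁻; ∈-cartesianProduct⁺; ∈-allFin)
open import Data.List.Relation.Unary.All as All using (All; []; _∷_)
open import Data.List.Relation.Unary.AllPairs using ([]; _∷_)
open import Data.List.Relation.Unary.Any using (here; there)
open import Data.List.Relation.Unary.Unique.Propositional using (Unique)
import Data.List.Relation.Unary.Unique.Propositional.Properties as Unique
open import Data.Nat using (ℕ; zero; suc; _≤_; _<_; z≤n; s≤s)
import Data.Nat as ℕ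
import Data.Nat.Properties as ℕ
open import Data.Product using (Σ-syntax; ∃-syntax; _×_; _,_; proj₁; proj₂)
open import Data.Product.Properties using (≡-dec)
open import Data.Sum using (_⊎_; inj₁; inj₂)
open import Data.Vec.Functional using (Vector)
open import Function using (_∘_; Equivalence)
open import Level using (0ℓ)
open import Relation.Binary using (Rel; Decidable)
open import Relation.Binary.Construct.Closure.ReflexiveTransitive using (Star; ε; _◅_)
open import Relation.Binary.PropositionalEquality
open import Relation.Nullary using (¬_; Dec; yes; no; does; contradiction)
open import Relation.Nullary.Decidable using (_×-dec_; ¬?; dec-true; dec-false)

open import Algebra.Properties.Semiring.Sum ℤ.+-*-semiring
  using (sum; sum-syntax; sum-cong-≗; ∑-distrib-+; ∑-comm; *-distribˡ-sum; sum-replicate-zero)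
import Algebra.Properties.CommutativeMonoid.Sum ℕ.+-0-commutativeMonoid as ℕ∑

private
  variable
    m n : ℕ
    x y : Fin n

-- Sums and indicators

-- The Iverson bracket. It depends only on `does p?`, so that `ι (Fin.suc s ≟ Fin.suc i)` reduces to
-- `ι (s ≟ i)`, which the induction in `∑-δ` uses.
ι : {P : Set} → Dec P → ℤ
ι p? = if does p? then 1ℤ else 0ℤ

ι-yes : {P : Set} (p? : Dec P) → P → ι p? ≡ 1ℤ
ι-yes p? p = cong (λ b → if b then 1ℤ else 0ℤ) (dec-true p? p)

ι-no : {P : Set} (p? : Dec P) → ¬ P → ι p? ≡ 0ℤ
ι-no p? ¬p = cong (λ b → if b then 1ℤ else 0ℤ) (dec-false p? ¬p)

ι*ι-yes : {P Q : Set} (p? : Dec P) (q? : Dec Q) → P → Q → ι p? * ι q? ≡ 1ℤ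
ι*ι-yes p? q? p q = cong₂ _*_ (ι-yes p? p) (ι-yes q? q)

ι*ι-no : {P Q : Set} (p? : Dec P) (q? : Dec Q) → ¬ (P × Q) → ι p? * ι q? ≡ 0ℤ
ι*ι-no (no _)  q? ¬pq = refl
ι*ι-no (yes p) q? ¬pq = trans (ℤ.*-identityˡ _) (ι-no q? λ q → ¬pq (p , q))

ι*ι-nonneg : {P Q : Set} (p? : Dec P) (q? : Dec Q) → 0ℤ ≤ℤ ι p? * ι q?
ι*ι-nonneg (yes _) (yes _) = +≤+ z≤n
ι*ι-nonneg (yes _) (no _)  = +≤+ z≤n
ι*ι-nonneg (no _)  _       = +≤+ z≤n

∑-zero : (f : Vector ℤ n) → (∀ i → f i ≡ 0ℤ) → sum f ≡ 0ℤ
∑-zero {n} f f≡0 = trans (sum-cong-≗ f≡0) (sum-replicate-zero n)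

∑-mono : (f g : Vector ℤ n) → (∀ i → f i ≤ℤ g i) → sum f ≤ℤ sum g
∑-mono {zero}  f g f≤g = ℤ.≤-refl
∑-mono {suc n} f g f≤g =
  ℤ.+-mono-≤ (f≤g Fin.zero) (∑-mono (f ∘ Fin.suc) (g ∘ Fin.suc) (f≤g ∘ Fin.suc))

+-tight : ∀ {a b c d} → a ≤ℤ b → c ≤ℤ d → b + d ≤ℤ a + c → b ≤ℤ a × d ≤ℤ c
+-tight {a} {b} {c} {d} a≤b c≤d b+d≤a+c =
  ℤ.≮⇒≥ (λ a<b → ℤ.<⇒≱ (ℤ.+-mono-<-≤ a<b c≤d) b+d≤a+c) ,
  ℤ.≮⇒≥ (λ c<d → ℤ.<⇒≱ (ℤ.+-mono-≤-< a≤b c<d) b+d≤a+c)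

-- One strict termwise inequality would make the inequality of the sums strict. This later turns a
-- flow as large as a cut into saturation of every single arc of the cut.
∑-tight : (f g : Vector ℤ n) → (∀ i → f i ≤ℤ g i) → sum g ≤ℤ sum f → ∀ i → g i ≤ℤ f i
∑-tight {suc n} f g f≤g ∑g≤∑f i
  with +-tight (f≤g Fin.zero) (∑-mono (f ∘ Fin.suc) (g ∘ Fin.suc) (f≤g ∘ Fin.suc)) ∑g≤∑f | i
... | g₀≤f₀ , _   | Fin.zero  = g₀≤f₀
... | _ , ∑g′≤∑f′ | Fin.suc j = ∑-tight (f ∘ Fin.suc) (g ∘ Fin.suc) (f≤g ∘ Fin.suc) ∑g′≤∑f′ j

∑-δ : (s : Fin n) (h : Vector ℤ n) → ∑[ i < n ] (ι (s ≟ i) * h i) ≡ h s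
∑-δ {suc n} Fin.zero h =
  trans (cong₂ _+_ (ℤ.*-identityˡ (h Fin.zero)) (∑-zero {n} _ λ _ → refl)) (ℤ.+-identityʳ _)
∑-δ {suc n} (Fin.suc s) h =
  trans (ℤ.+-identityˡ _) (∑-δ s (h ∘ Fin.suc))

∑-neg : (f : Vector ℤ n) → ∑[ i < n ] (- f i) ≡ - sum f
∑-neg {n} f = begin
  ∑[ i < n ] (- f i)       ≡⟨ sum-cong-≗ (λ i → sym (ℤ.-1*i≡-i (f i))) ⟩
  ∑[ i < n ] (-1ℤ * f i)   ≡⟨ sym (*-distribˡ-sum -1ℤ f) ⟩
  -1ℤ * sum f              ≡⟨ ℤ.-1*i≡-i (sum f) ⟩
  - sum f                  ∎
  where open ≡-Reasoning

-- At most one term is positive, so the sum is bounded by that term alone. Serves to bound the load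
-- that edge-disjoint paths put on one arc.
∑-exclusive : ∀ {c} → 0ℤ ≤ℤ c → (f : Vector ℤ n) → (∀ i → f i ≤ℤ c) →
              (∀ i j → i ≢ j → f i ≤ℤ 0ℤ ⊎ f j ≤ℤ 0ℤ) → sum f ≤ℤ c
∑-exclusive {zero}  0≤c f f≤c excl = 0≤c
∑-exclusive {suc n} {c} 0≤c f f≤c excl with f Fin.zero ≤ℤ? 0ℤ
... | yes f₀≤0 = ℤ.≤-trans
  (ℤ.+-mono-≤ f₀≤0 (∑-exclusive 0≤c (f ∘ Fin.suc) (f≤c ∘ Fin.suc)
                      λ i j i≢j → excl _ _ (i≢j ∘ Finₚ.suc-injective)))
  (ℤ.≤-reflexive (ℤ.+-identityˡ c))
... | no f₀≰0 = ℤ.≤-trans (ℤ.+-mono-≤ (f≤c Fin.zero) rest≤0) (ℤ.≤-reflexive (ℤ.+-identityʳ c))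
  where
  f≤0 : ∀ i → f (Fin.suc i) ≤ℤ 0ℤ
  f≤0 i with excl Fin.zero (Fin.suc i) (λ ())
  ... | inj₁ f₀≤0 = contradiction f₀≤0 f₀≰0
  ... | inj₂ fᵢ≤0 = fᵢ≤0

  rest≤0 : sum (f ∘ Fin.suc) ≤ℤ 0ℤ
  rest≤0 = ℤ.≤-trans (∑-mono (f ∘ Fin.suc) _ f≤0) (ℤ.≤-reflexive (∑-zero {n} (λ _ → 0ℤ) λ _ → refl))

-- Cuts

𝟙 : Subset n → Fin n → ℤ
𝟙 X a = ι (a ∈? X)

crossing : Subset n → (Fin n → Fin n → ℤ) → ℤ
crossing {n} X g = ∑[ a < n ] ∑[ b < n ] (𝟙 X a * 𝟙 (∁ X) b * g a b)

-- Each edge with ends on both sides counts once, since only its arc directed out of `X` has nonzero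
-- weight.
cut : Graph n → Subset n → ℤ
cut H X = crossing X λ a b → + capacity H a b

-- For a skew `g`, this is the net outflow at `a`.
excess : (Fin n → Fin n → ℤ) → Fin n → ℤ
excess {n} g a = ∑[ b < n ] g a b

Skew : (Fin n → Fin n → ℤ) → Set
Skew g = ∀ a b → g a b ≡ - g b a

𝟙-∁ : (X : Subset n) (a : Fin n) → 𝟙 X a + 𝟙 (∁ X) a ≡ 1ℤ
𝟙-∁ X a with a ∈? X
... | yes a∈X = cong (λ z → 1ℤ + z) (ι-no (a ∈? ∁ X) (x∈p⇒x∉∁p a∈X))
... | no  a∉X = cong (λ z → 0ℤ + z) (ι-yes (a ∈? ∁ X) (x∉p⇒x∈∁p a∉X))

𝟙-∁∁ : (X : Subset n) (a : Fin n) → 𝟙 (∁ (∁ X)) a ≡ 𝟙 X a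
𝟙-∁∁ X a with a ∈? X
... | yes a∈X = ι-yes (a ∈? ∁ (∁ X)) (x∉p⇒x∈∁p (x∈p⇒x∉∁p a∈X))
... | no  a∉X = ι-no (a ∈? ∁ (∁ X)) λ a∈ → x∈∁p⇒x∉p a∈ (x∉p⇒x∈∁p a∉X)

module _ (X : Subset n) {g h : Fin n → Fin n → ℤ}
         (g≤h : ∀ a b → a ∈ X → b ∉ X → g a b ≤ℤ h a b) where

  private
    weighted-≤ : ∀ a b → 𝟙 X a * 𝟙 (∁ X) b * g a b ≤ℤ 𝟙 X a * 𝟙 (∁ X) b * h a b
    weighted-≤ a b with a ∈? X | b ∈? ∁ X
    ... | yes a∈X | yes b∈∁X =
      subst₂ _≤ℤ_ (sym (ℤ.*-identityˡ _)) (sym (ℤ.*-identityˡ _)) (g≤h a b a∈X (x∈∁p⇒x∉p b∈∁X))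
    ... | yes _   | no _     = ℤ.≤-refl
    ... | no _    | yes _    = ℤ.≤-refl
    ... | no _    | no _     = ℤ.≤-refl

  crossing-mono : crossing X g ≤ℤ crossing X h
  crossing-mono = ∑-mono _ _ λ a → ∑-mono _ _ (weighted-≤ a)

  crossing-tight : crossing X h ≤ℤ crossing X g → ∀ a b → a ∈ X → b ∉ X → h a b ≤ℤ g a b
  crossing-tight h≤g a b a∈X b∉X = subst₂ _≤ℤ_ (unweight (h a b)) (unweight (g a b))
    (∑-tight _ _ (weighted-≤ a)
      (∑-tight _ _ (λ c → ∑-mono _ _ (weighted-≤ c)) h≤g a) b)
    where
    unweight : ∀ z → 𝟙 X a * 𝟙 (∁ X) b * z ≡ z
    unweight z = trans (cong (_* z) (ι*ι-yes (a ∈? X) (b ∈? ∁ X) a∈X (x∉p⇒x∈∁p b∉X)))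
                       (ℤ.*-identityˡ z)

-- The product of indicators singles out the arc from `s` to `t`. Two uses of `∑-δ` collapse its
-- double sum to the weight of that arc, which is 1 because the arc leaves `X`.
crossing-add-arc : (X : Subset n) {s t : Fin n} (g : Fin n → Fin n → ℤ) → s ∈ X → t ∉ X →
                   crossing X (λ a b → ι (s ≟ a) * ι (t ≟ b) + g a b) ≡ 1ℤ + crossing X g
crossing-add-arc {n} X {s} {t} g s∈X t∉X = begin
  ∑[ a < n ] ∑[ b < n ] (𝟙 X a * 𝟙 (∁ X) b * (ι (s ≟ a) * ι (t ≟ b) + g a b))
    ≡⟨ (sum-cong-≗ λ a → trans
          (sum-cong-≗ λ b → rearrange (𝟙 X a) (𝟙 (∁ X) b) (ι (s ≟ a)) (ι (t ≟ b)) (g a b))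
          (∑-distrib-+ (λ b → ι (t ≟ b) * (ι (s ≟ a) * (𝟙 X a * 𝟙 (∁ X) b))) _)) ⟩
  ∑[ a < n ] ( ∑[ b < n ] (ι (t ≟ b) * (ι (s ≟ a) * (𝟙 X a * 𝟙 (∁ X) b)))
             + ∑[ b < n ] (𝟙 X a * 𝟙 (∁ X) b * g a b))
    ≡⟨ ∑-distrib-+ (λ a → ∑[ b < n ] (ι (t ≟ b) * (ι (s ≟ a) * (𝟙 X a * 𝟙 (∁ X) b)))) _ ⟩
  ∑[ a < n ] ∑[ b < n ] (ι (t ≟ b) * (ι (s ≟ a) * (𝟙 X a * 𝟙 (∁ X) b))) + crossing X g
    ≡⟨ cong (_+ crossing X g) (sum-cong-≗ λ a → ∑-δ t λ b → ι (s ≟ a) * (𝟙 X a * 𝟙 (∁ X) b)) ⟩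
  ∑[ a < n ] (ι (s ≟ a) * (𝟙 X a * 𝟙 (∁ X) t)) + crossing X g
    ≡⟨ cong (_+ crossing X g) (∑-δ s λ a → 𝟙 X a * 𝟙 (∁ X) t) ⟩
  𝟙 X s * 𝟙 (∁ X) t + crossing X g
    ≡⟨ cong (_+ crossing X g) (ι*ι-yes (s ∈? X) (t ∈? ∁ X) s∈X (x∉p⇒x∈∁p t∉X)) ⟩
  1ℤ + crossing X g ∎
  where
  open ≡-Reasoning
  rearrange : ∀ p q d e z → p * q * (d * e + z) ≡ e * (d * (p * q)) + p * q * z
  rearrange = solve-∀

crossing-∁ : (X : Subset n) {g : Fin n → Fin n → ℤ} → (∀ a b → g a b ≡ g b a) →
             crossing (∁ X) g ≡ crossing X g
crossing-∁ {n} X {g} g-sym = trans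
  (∑-comm λ a b → 𝟙 (∁ X) a * 𝟙 (∁ (∁ X)) b * g a b)
  (sum-cong-≗ λ a → sum-cong-≗ λ b →
    cong₂ _*_ (trans (cong (𝟙 (∁ X) b *_) (𝟙-∁∁ X a)) (ℤ.*-comm (𝟙 (∁ X) b) (𝟙 X a))) (g-sym b a))

self-negative⇒0 : ∀ {z} → z ≡ - z → z ≡ 0ℤ
self-negative⇒0 { + zero}   _  = refl
self-negative⇒0 {+[1+ _ ]} ()
self-negative⇒0 { -[1+ _ ]} ()

-- Arcs with both ends in X cancel in pairs.
∑-excess : (X : Subset n) {g : Fin n → Fin n → ℤ} → Skew g →
           ∑[ a < n ] (𝟙 X a * excess g a) ≡ crossing X g
∑-excess {n} X {g} skew = begin
  ∑[ a < n ] (𝟙 X a * excess g a)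
    ≡⟨ (sum-cong-≗ λ a → *-distribˡ-sum (𝟙 X a) (g a)) ⟩
  ∑[ a < n ] ∑[ b < n ] (𝟙 X a * g a b)
    ≡⟨ (sum-cong-≗ λ a → trans
         (sum-cong-≗ λ b → trans (split a b)
                                 (rearrange (𝟙 X a) (𝟙 X b) (𝟙 (∁ X) b) (g a b)))
         (∑-distrib-+ (inner a) λ b → 𝟙 X a * 𝟙 (∁ X) b * g a b)) ⟩
  ∑[ a < n ] (∑[ b < n ] inner a b + ∑[ b < n ] (𝟙 X a * 𝟙 (∁ X) b * g a b))
    ≡⟨ ∑-distrib-+ (λ a → ∑[ b < n ] inner a b) _ ⟩
  ∑[ a < n ] ∑[ b < n ] inner a b + crossing X g
    ≡⟨ cong (_+ crossing X g) (self-negative⇒0 inner-skew) ⟩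
  0ℤ + crossing X g
    ≡⟨ ℤ.+-identityˡ _ ⟩
  crossing X g ∎
  where
  open ≡-Reasoning
  inner : Fin n → Fin n → ℤ
  inner a b = 𝟙 X a * 𝟙 X b * g a b

  rearrange : ∀ p q q′ z → (q + q′) * (p * z) ≡ p * q * z + p * q′ * z
  rearrange = solve-∀

  split : ∀ a b → 𝟙 X a * g a b ≡ (𝟙 X b + 𝟙 (∁ X) b) * (𝟙 X a * g a b)
  split a b = sym (trans (cong (_* (𝟙 X a * g a b)) (𝟙-∁ X b)) (ℤ.*-identityˡ _))

  swap-neg : ∀ p q z → p * q * - z ≡ - (q * p * z)
  swap-neg = solve-∀

  inner-skew : ∑[ a < n ] ∑[ b < n ] inner a b ≡ - ∑[ a < n ] ∑[ b < n ] inner a b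
  inner-skew = begin
    ∑[ a < n ] ∑[ b < n ] inner a b
      ≡⟨ (sum-cong-≗ λ a → trans
           (sum-cong-≗ λ b → trans (cong (𝟙 X a * 𝟙 X b *_) (skew a b))
                                   (swap-neg (𝟙 X a) (𝟙 X b) (g b a)))
           (∑-neg λ b → inner b a)) ⟩
    ∑[ a < n ] (- ∑[ b < n ] inner b a)
      ≡⟨ ∑-neg (λ a → ∑[ b < n ] inner b a) ⟩
    - ∑[ a < n ] ∑[ b < n ] inner b a
      ≡⟨ cong -_ (∑-comm λ a b → inner b a) ⟩
    - ∑[ b < n ] ∑[ a < n ] inner b a ∎

-- In the sum of excesses over `X` only `x` contributes: `y` lies outside `X` and all other vertices
-- are balanced.
excess-across : (X : Subset n) {g : Fin n → Fin n → ℤ} → Skew g → x ∈ X → y ∉ X →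
                (∀ a → a ≢ x → a ≢ y → excess g a ≡ 0ℤ) → crossing X g ≡ excess g x
excess-across {x = x} {y} X {g} skew x∈X y∉X balanced = begin
  crossing X g                   ≡⟨ sym (∑-excess X skew) ⟩
  sum (λ a → 𝟙 X a * excess g a)  ≡⟨ sum-cong-≗ only-x ⟩
  sum (λ a → ι (x ≟ a) * excess g a) ≡⟨ ∑-δ x (excess g) ⟩
  excess g x ∎
  where
  open ≡-Reasoning
  only-x : ∀ a → 𝟙 X a * excess g a ≡ ι (x ≟ a) * excess g a
  only-x a with x ≟ a
  ... | yes refl = cong (_* excess g a) (ι-yes (a ∈? X) x∈X)
  ... | no x≢a with a ≟ y
  ...   | yes refl = cong (_* excess g a) (ι-no (a ∈? X) y∉X)
  ...   | no a≢y   = trans (cong (𝟙 X a *_) (balanced a (x≢a ∘ sym) a≢y)) (ℤ.*-zeroʳ (𝟙 X a))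

-- Unit flows along simple paths

capacity-yes : (H : Graph n) {a b : Fin n} → Adj H a b → capacity H a b ≡ 1
capacity-yes H {a} {b} ab with Adj? H a b
... | yes _  = refl
... | no ¬ab = contradiction ab ¬ab

capacity-no : (H : Graph n) {a b : Fin n} → ¬ Adj H a b → capacity H a b ≡ 0
capacity-no H {a} {b} ¬ab with Adj? H a b
... | yes ab = contradiction ab ¬ab
... | no _   = refl

capacity≤1 : (H : Graph n) (a b : Fin n) → capacity H a b ≤ 1
capacity≤1 H a b with Adj? H a b
... | yes _ = s≤s z≤n
... | no _  = z≤n

capacity-mono : (H K : Graph n) {a b : Fin n} → (Adj H a b → Adj K a b) →
                capacity H a b ≤ capacity K a b
capacity-mono H K {a} {b} H⊆K with Adj? H a b
... | yes ab = ℕ.≤-reflexive (sym (capacity-yes K (H⊆K ab)))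
... | no _   = z≤n

capacity-sym : (H : Graph n) (a b : Fin n) → capacity H a b ≡ capacity H b a
capacity-sym H a b = ℕ.≤-antisym (below a b) (below b a)
  where
  below : ∀ a b → capacity H a b ≤ capacity H b a
  below a b with Adj? H a b
  ... | yes ab = ℕ.≤-reflexive (sym (capacity-yes H (Adj-sym H ab)))
  ... | no _   = z≤n

0<capacity⇒Adj : (H : Graph n) {a b : Fin n} → 0ℤ <ℤ + capacity H a b → Adj H a b
0<capacity⇒Adj H {a} {b} pos with Adj? H a b
... | yes ab = ab
0<capacity⇒Adj H {a} {b} (+<+ ()) | no _

-- The skew unit flow on one arc: for distinct ends, 1 on `(s , t)` and -1 on `(t , s)`.
arcFlow : (s t a b : Fin n) → ℤ
arcFlow s t a b = ι (s ≟ a) * ι (t ≟ b) - ι (t ≟ a) * ι (s ≟ b)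

module _ {H : Graph n} where

  walkFlow : ∀ {x y} → Star (Adj H) x y → Fin n → Fin n → ℤ
  walkFlow ε a b                   = 0ℤ
  walkFlow (_◅_ {s} {t} _ w) a b = arcFlow s t a b + walkFlow w a b

  walkFlow-skew : ∀ {x y} (w : Star (Adj H) x y) → Skew (walkFlow w)
  walkFlow-skew ε a b = refl
  walkFlow-skew (_◅_ {s} {t} _ w) a b = trans
    (cong (λ z → arcFlow s t a b + z) (walkFlow-skew w a b))
    (swap (ι (s ≟ a)) (ι (t ≟ b)) (ι (t ≟ a)) (ι (s ≟ b)) (walkFlow w b a))
    where
    swap : ∀ p q r o z → p * q - r * o + - z ≡ - (o * r - q * p + z)
    swap = solve-∀

  -- The excesses of consecutive arcs telescope, leaving only the two ends of the walk.
  walkFlow-excess : ∀ {x y} (w : Star (Adj H) x y) a →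
                    excess (walkFlow w) a ≡ ι (x ≟ a) - ι (y ≟ a)
  walkFlow-excess {x} ε a = trans (∑-zero {n} _ λ _ → refl) (sym (ℤ.+-inverseʳ (ι (x ≟ a))))
  walkFlow-excess {y = y} (_◅_ {s} {t} _ w) a = begin
    ∑[ b < n ] (arcFlow s t a b + walkFlow w a b)
      ≡⟨ ∑-distrib-+ (arcFlow s t a) (walkFlow w a) ⟩
    ∑[ b < n ] (ι (s ≟ a) * ι (t ≟ b) - ι (t ≟ a) * ι (s ≟ b)) + excess (walkFlow w) a
      ≡⟨ cong₂ _+_ arc-excess (walkFlow-excess w a) ⟩
    ι (s ≟ a) - ι (t ≟ a) + (ι (t ≟ a) - ι (y ≟ a))
      ≡⟨ telescope (ι (s ≟ a)) (ι (t ≟ a)) (ι (y ≟ a)) ⟩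
    ι (s ≟ a) - ι (y ≟ a) ∎
    where
    open ≡-Reasoning
    telescope : ∀ p q r → p - q + (q - r) ≡ p - r
    telescope = solve-∀

    arc-excess : ∑[ b < n ] (ι (s ≟ a) * ι (t ≟ b) - ι (t ≟ a) * ι (s ≟ b)) ≡ ι (s ≟ a) - ι (t ≟ a)
    arc-excess = begin
      ∑[ b < n ] (ι (s ≟ a) * ι (t ≟ b) - ι (t ≟ a) * ι (s ≟ b))
        ≡⟨ sum-cong-≗ {n} (λ b → cong₂ _-_ (ℤ.*-comm (ι (s ≟ a)) (ι (t ≟ b)))
                                            (ℤ.*-comm (ι (t ≟ a)) (ι (s ≟ b)))) ⟩
      ∑[ b < n ] (ι (t ≟ b) * ι (s ≟ a) - ι (s ≟ b) * ι (t ≟ a))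
        ≡⟨ ∑-distrib-+ (λ b → ι (t ≟ b) * ι (s ≟ a)) (λ b → - (ι (s ≟ b) * ι (t ≟ a))) ⟩
      ∑[ b < n ] (ι (t ≟ b) * ι (s ≟ a)) + ∑[ b < n ] (- (ι (s ≟ b) * ι (t ≟ a)))
        ≡⟨ cong₂ _+_ (∑-δ t λ _ → ι (s ≟ a))
                     (trans (∑-neg λ b → ι (s ≟ b) * ι (t ≟ a)) (cong -_ (∑-δ s λ _ → ι (t ≟ a)))) ⟩
      ι (s ≟ a) - ι (t ≟ a) ∎

  source∈vertices : ∀ {x y} (w : Star (Adj H) x y) → x List.∈ vertices {H = H} w
  source∈vertices ε       = here refl
  source∈vertices (_ ◅ w) = here refl

  edge-ends : ∀ {x y a b} (w : Star (Adj H) x y) → (a , b) List.∈ edges {H = H} w →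
              a List.∈ vertices {H = H} w × b List.∈ vertices {H = H} w
  edge-ends (_ ◅ w) (here refl) = here refl , there (source∈vertices w)
  edge-ends (_ ◅ w) (there ab)  = let a∈ , b∈ = edge-ends w ab in there a∈ , there b∈

  edge-Adj : ∀ {x y a b} (w : Star (Adj H) x y) → (a , b) List.∈ edges {H = H} w → Adj H a b
  edge-Adj (xz ◅ w) (here refl) = xz
  edge-Adj (_ ◅ w)  (there ab)  = edge-Adj w ab

  data OnWalk {x y} (w : Star (Adj H) x y) (a b : Fin n) : Set where
    forward  : (a , b) List.∈ edges {H = H} w → walkFlow w a b ≡ 1ℤ  → OnWalk w a b
    backward : (b , a) List.∈ edges {H = H} w → walkFlow w a b ≡ -1ℤ → OnWalk w a b
    off      : ¬ (a , b) List.∈ edges {H = H} w → ¬ (b , a) List.∈ edges {H = H} w →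
               walkFlow w a b ≡ 0ℤ → OnWalk w a b

  -- By simplicity the first vertex `s` does not recur, so the remaining walk uses neither `(s , t)`
  -- nor `(t , s)` and its flow vanishes there. Hence contributions never accumulate and the values
  -- are only 1, -1 and 0.
  onWalk : ∀ {x y} (w : Star (Adj H) x y) → Unique (vertices {H = H} w) → ∀ a b → OnWalk w a b
  onWalk ε _ a b = off (λ ()) (λ ()) refl
  onWalk (_◅_ {s} {t} _ w) (s∉ ∷ uniq) a b
    with (s ≟ a) ×-dec (t ≟ b) | (t ≟ a) ×-dec (s ≟ b)
  ... | yes (refl , refl) | _ = forward (here refl)
    (cong₂ _+_
      (cong₂ _-_ (ι*ι-yes (s ≟ s) (t ≟ t) refl refl) (ι*ι-no (t ≟ s) (s ≟ t) (s≢t ∘ proj₂)))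
      (w-off (onWalk w uniq s t)))
    where
    s≢t : s ≢ t
    s≢t = All.lookup s∉ (source∈vertices w)
    w-off : OnWalk w s t → walkFlow w s t ≡ 0ℤ
    w-off (forward st _)  = contradiction refl (All.lookup s∉ (proj₁ (edge-ends w st)))
    w-off (backward ts _) = contradiction refl (All.lookup s∉ (proj₂ (edge-ends w ts)))
    w-off (off _ _ ≡0)    = ≡0
  ... | no _ | yes (refl , refl) = backward (here refl)
    (cong₂ _+_
      (cong₂ _-_ (ι*ι-no (s ≟ t) (t ≟ s) (s≢t ∘ proj₁)) (ι*ι-yes (t ≟ t) (s ≟ s) refl refl))
      (w-off (onWalk w uniq t s)))
    where
    s≢t : s ≢ t
    s≢t = All.lookup s∉ (source∈vertices w)
    w-off : OnWalk w t s → walkFlow w t s ≡ 0ℤ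
    w-off (forward ts _)  = contradiction refl (All.lookup s∉ (proj₂ (edge-ends w ts)))
    w-off (backward st _) = contradiction refl (All.lookup s∉ (proj₁ (edge-ends w st)))
    w-off (off _ _ ≡0)    = ≡0
  ... | no ¬st | no ¬ts = extend (onWalk w uniq a b)
    where
    tail-only : ∀ {z} → walkFlow w a b ≡ z → arcFlow s t a b + walkFlow w a b ≡ z
    tail-only eq = trans
      (cong₂ _+_ (cong₂ _-_ (ι*ι-no (s ≟ a) (t ≟ b) ¬st) (ι*ι-no (t ≟ a) (s ≟ b) ¬ts)) eq)
      (ℤ.+-identityˡ _)
    extend : OnWalk w a b → OnWalk (_ ◅ w) a b
    extend (forward ab eq)  = forward (there ab) (tail-only eq)
    extend (backward ba eq) = backward (there ba) (tail-only eq)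
    extend (off ¬ab ¬ba eq) =
      off (λ { (here refl) → ¬st (refl , refl) ; (there ab) → ¬ab ab })
          (λ { (here refl) → ¬ts (refl , refl) ; (there ba) → ¬ba ba }) (tail-only eq)

  arcs : ∀ {x y} → Path H x y → List (Fin n × Fin n)
  arcs p = edges {H = H} (walk p)

  pathFlow : ∀ {x y} → Path H x y → Fin n → Fin n → ℤ
  pathFlow p = walkFlow (walk p)

  pathFlow-skew : ∀ {x y} (p : Path H x y) → Skew (pathFlow p)
  pathFlow-skew p = walkFlow-skew (walk p)

  pathFlow-excess : ∀ {x y} (p : Path H x y) a → excess (pathFlow p) a ≡ ι (x ≟ a) - ι (y ≟ a)
  pathFlow-excess p = walkFlow-excess (walk p)

  arc⇒Adj : ∀ {x y a b} (p : Path H x y) → (a , b) List.∈ arcs p → Adj H a b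
  arc⇒Adj p = edge-Adj (walk p)

  onPath : ∀ {x y} (p : Path H x y) a b → OnWalk (walk p) a b
  onPath p = onWalk (walk p) (simple p)

-- Growing backwards from y the set of vertices that reach y keeps the paths
-- simple: the new vertex lies outside the set, hence off the path it extends.
module _ (H : Graph n) {R : Rel (Fin n) 0ℓ} (R? : Decidable R)
         (R⇒Adj : ∀ {a b} → R a b → Adj H a b) {y : Fin n} where

  private
    Reach : Subset n → Fin n → Set
    Reach U a = Σ[ p ∈ Path H a y ]
      (All (_∈ U) (vertices {H = H} (walk p)) × All (λ (c , d) → R c d) (arcs p))

    grow : (U : Subset n) → Acc (λ p q → q ⊂ p) U → y ∈ U → (∀ a → a ∈ U → Reach U a) →
           Σ[ W ∈ Subset n ] (y ∈ W × (∀ a → a ∈ W → Reach W a) × (∀ a b → a ∉ W → b ∈ W → ¬ R a b))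
    grow U (acc larger) y∈U reach
      with any? (λ a → ¬? (a ∈? U) ×-dec any? (λ b → (b ∈? U) ×-dec R? a b))
    ... | no closed = U , y∈U , reach , λ a b a∉U b∈U ab → closed (a , a∉U , b , b∈U , ab)
    ... | yes (a , a∉U , b , b∈U , ab) =
      -- The recursion descends along strict inclusion: `U′` contains `a`, which `U` lacks.
      grow U′ (larger (p⊆p∪q _ , a , a∈U′ , a∉U)) (p⊆p∪q _ y∈U) reach′
      where
      U′ : Subset n
      U′ = U ∪ ⁅ a ⁆

      a∈U′ : a ∈ U′
      a∈U′ = q⊆p∪q U ⁅ a ⁆ (x∈⁅x⁆ a)

      reach′ : ∀ c → c ∈ U′ → Reach U′ c
      reach′ c c∈U′ with x∈p∪q⁻ U ⁅ a ⁆ c∈U′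
      ... | inj₁ c∈U = let p , in-U , in-R = reach c c∈U in p , All.map (p⊆p∪q _) in-U , in-R
      ... | inj₂ c∈a with refl ← x∈⁅y⁆⇒x≡y a c∈a | p , in-U , in-R ← reach b b∈U =
        record { walk   = R⇒Adj ab ◅ walk p
               ; simple = All.map (λ d∈U a≡d → a∉U (subst (_∈ U) (sym a≡d) d∈U)) in-U ∷ simple p } ,
        a∈U′ ∷ All.map (p⊆p∪q _) in-U , ab ∷ in-R

  -- If `x` is not among the vertices that reach `y` along `R`, their complement is a cut that no
  -- `R`-arc leaves. Taking positive arcs for `R` extracts a path from a flow; taking unsaturated
  -- arcs finds an augmenting path.
  path-or-cut : ∀ x →
    Σ[ p ∈ Path H x y ] All (λ (c , d) → R c d) (arcs p) ⊎
    Σ[ X ∈ Subset n ] (x ∈ X × y ∉ X × (∀ a b → a ∈ X → b ∉ X → ¬ R a b))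
  path-or-cut x with grow ⁅ y ⁆ (⊃-wellFounded _) (x∈⁅x⁆ y) start
    where
    start : ∀ a → a ∈ ⁅ y ⁆ → Reach ⁅ y ⁆ a
    start a a∈y with refl ← x∈⁅y⁆⇒x≡y y a∈y =
      record { walk = ε ; simple = [] ∷ [] } , x∈⁅x⁆ y ∷ [] , []
  ... | W , y∈W , reach , closed with x ∈? W
  ...   | yes x∈W = let p , _ , in-R = reach x x∈W in inj₁ (p , in-R)
  ...   | no  x∉W = inj₂ (∁ W , x∉p⇒x∈∁p x∉W , x∈p⇒x∉∁p y∈W ,
    λ a b a∈∁W b∉∁W → closed a b (x∈∁p⇒x∉p a∈∁W) (x∉∁p⇒x∈p b∉∁W))

-- Menger's theorem

-- `supply` states value and conservation at once: for distinct `x` and `y` the excess is `m` at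
-- `x`, `- m` at `y` and 0 elsewhere. By `skew`, the upper bound on the reverse arc is a lower bound
-- on `g a b`.
record SkewFlow (H : Graph n) (x y : Fin n) (m : ℕ) (g : Fin n → Fin n → ℤ) : Set where
  field
    skew   : Skew g
    bound  : ∀ a b → g a b ≤ℤ + capacity H a b
    supply : ∀ a → excess g a ≡ + m * (ι (x ≟ a) - ι (y ≟ a))

module _ {H : Graph n} {x y : Fin n} {m : ℕ} {g : Fin n → Fin n → ℤ} (F : SkewFlow H x y m g) where
  open SkewFlow F

  flow-across : ∀ {X} → x ∈ X → y ∉ X → crossing X g ≡ + m
  flow-across {X} x∈X y∉X = trans (excess-across X skew x∈X y∉X balanced) excess-x
    where
    open ≡-Reasoning
    excess-x : excess g x ≡ + m
    excess-x = begin
      excess g x                        ≡⟨ supply x ⟩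
      + m * (ι (x ≟ x) - ι (y ≟ x))     ≡⟨ cong (λ z → + m * z)
        (cong₂ _-_ (ι-yes (x ≟ x) refl) (ι-no (y ≟ x) λ { refl → y∉X x∈X })) ⟩
      + m * 1ℤ                          ≡⟨ ℤ.*-identityʳ (+ m) ⟩
      + m                               ∎
    balanced : ∀ a → a ≢ x → a ≢ y → excess g a ≡ 0ℤ
    balanced a a≢x a≢y = begin
      excess g a                        ≡⟨ supply a ⟩
      + m * (ι (x ≟ a) - ι (y ≟ a))     ≡⟨ cong (λ z → + m * z)
        (cong₂ _-_ (ι-no (x ≟ a) (a≢x ∘ sym)) (ι-no (y ≟ a) (a≢y ∘ sym))) ⟩
      + m * 0ℤ                          ≡⟨ ℤ.*-zeroʳ (+ m) ⟩
      0ℤ                                ∎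

  -- Weak duality: the whole value crosses the cut, on arcs bounded by their capacities.
  flow≤cut : ∀ {X} → x ∈ X → y ∉ X → + m ≤ℤ cut H X
  flow≤cut {X} x∈X y∉X = ℤ.≤-trans (ℤ.≤-reflexive (sym (flow-across x∈X y∉X)))
                                   (crossing-mono X λ a b _ _ → bound a b)

  positive⇒Adj : ∀ {a b} → 0ℤ <ℤ g a b → Adj H a b
  positive⇒Adj {a} {b} 0<g = 0<capacity⇒Adj H (ℤ.<-≤-trans 0<g (bound a b))

  reverse-negative : ∀ {a b} → 0ℤ <ℤ g b a → g a b <ℤ 0ℤ
  reverse-negative {a} {b} 0<g = subst (_<ℤ 0ℤ) (sym (skew a b)) (ℤ.neg-mono-< 0<g)

  -- Without an edge the capacity is 0, so an unsaturated arc has negative flow; its reverse is then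
  -- positive and must lie on an edge. Hence residual paths are paths of `H`.
  unsaturated⇒Adj : ∀ {a b} → g a b <ℤ + capacity H a b → Adj H a b
  unsaturated⇒Adj {a} {b} g<c with Adj? H a b
  ... | yes ab = ab
  ... | no _   = Adj-sym H (positive⇒Adj (subst (0ℤ <ℤ_) (sym (skew b a)) (ℤ.neg-mono-< g<c)))

  -- By integrality an unsaturated arc has room for a full unit; on arcs traversed backwards the
  -- flow only decreases.
  augment : (p : Path H x y) →
            All (λ (a , b) → g a b <ℤ + capacity H a b) (arcs p) →
            SkewFlow H x y (suc m) (λ a b → pathFlow p a b + g a b)
  augment p unsaturated = record
    { skew   = λ a b → trans (cong₂ _+_ (pathFlow-skew p a b) (skew a b))
                             (sym (ℤ.neg-distrib-+ (pathFlow p b a) (g b a)))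
    ; bound  = bound′
    ; supply = λ a → trans (∑-distrib-+ (pathFlow p a) (g a))
                    (trans (cong₂ _+_ (pathFlow-excess p a) (supply a))
                           (sym (ℤ.suc-* (+ m) (ι (x ≟ a) - ι (y ≟ a)))))
    }
    where
    bound′ : ∀ a b → pathFlow p a b + g a b ≤ℤ + capacity H a b
    bound′ a b with onPath p a b
    ... | forward ab eq rewrite eq = ℤ.i<j⇒suc[i]≤j (All.lookup unsaturated ab)
    ... | backward _ eq rewrite eq = ℤ.i≤j⇒pred[i]≤j (bound a b)
    ... | off _ _ eq    rewrite eq | ℤ.+-identityˡ (g a b) = bound a b

-- Decomposition of flows into edge-disjoint paths, and back

module Peel {H : Graph n} {x y : Fin n} {m : ℕ} {g : Fin n → Fin n → ℤ}
            (F : SkewFlow H x y (suc m) g) (p : Path H x y)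
            (positive : All (λ (a , b) → 0ℤ <ℤ g a b) (arcs p)) where
  open SkewFlow F

  peeled : Fin n → Fin n → ℤ
  peeled a b = g a b - pathFlow p a b

  -- On a path arc the flow is at most 1, so removing a unit leaves nothing positive. On the reverse
  -- of a path arc the flow is negative, so adding a unit leaves nothing positive either. Thus
  -- positive arcs of the remainder avoid the edges of the path in both directions.
  peeled-cases : ∀ a b → peeled a b ≤ℤ 0ℤ ⊎
    (¬ (a , b) List.∈ arcs p × ¬ (b , a) List.∈ arcs p ×
     peeled a b ≡ g a b)
  peeled-cases a b with onPath p a b
  ... | forward _ eq rewrite eq =
    inj₁ (ℤ.i≤j⇒i-j≤0 (ℤ.≤-trans (bound a b) (+≤+ (capacity≤1 H a b))))
  ... | backward ba eq rewrite eq | ℤ.+-comm (g a b) 1ℤ =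
    inj₁ (ℤ.i<j⇒suc[i]≤j (reverse-negative F (All.lookup positive ba)))
  ... | off ¬ab ¬ba eq rewrite eq = inj₂ (¬ab , ¬ba , ℤ.+-identityʳ (g a b))

  peeled-flow : SkewFlow H x y m peeled
  peeled-flow = record
    { skew   = λ a b → trans (cong₂ _-_ (skew a b) (pathFlow-skew p a b))
                             (neg-sub (g b a) (pathFlow p b a))
    ; bound  = bound′
    ; supply = supply′
    }
    where
    neg-sub : ∀ i j → - i - (- j) ≡ - (i - j)
    neg-sub = solve-∀

    bound′ : ∀ a b → peeled a b ≤ℤ + capacity H a b
    bound′ a b with peeled-cases a b
    ... | inj₁ ≤0           = ℤ.≤-trans ≤0 (+≤+ z≤n)
    ... | inj₂ (_ , _ , eq) = subst (_≤ℤ + capacity H a b) (sym eq) (bound a b)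

    supply′ : ∀ a → excess peeled a ≡ + m * (ι (x ≟ a) - ι (y ≟ a))
    supply′ a = begin
      excess peeled a
        ≡⟨ ∑-distrib-+ (g a) (λ b → - pathFlow p a b) ⟩
      excess g a + ∑[ b < n ] (- pathFlow p a b)
        ≡⟨ cong₂ _+_ (trans (supply a) (ℤ.suc-* (+ m) d))
                     (trans (∑-neg (pathFlow p a)) (cong -_ (pathFlow-excess p a))) ⟩
      d + + m * d - d
        ≡⟨ cancel d (+ m * d) ⟩
      + m * d ∎
      where
      open ≡-Reasoning
      d : ℤ
      d = ι (x ≟ a) - ι (y ≟ a)
      cancel : ∀ i j → i + j - i ≡ j
      cancel = solve-∀

  peeled-positive⇒ : ∀ {a b} → 0ℤ <ℤ peeled a b → 0ℤ <ℤ g a b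
  peeled-positive⇒ {a} {b} 0<h with peeled-cases a b
  ... | inj₁ ≤0           = contradiction ≤0 (ℤ.<⇒≱ 0<h)
  ... | inj₂ (_ , _ , eq) = subst (0ℤ <ℤ_) eq 0<h

  peeled-positive⇒disjoint : ∀ {d a b} → d List.∈ arcs p → 0ℤ <ℤ peeled a b →
                             ¬ SameEdge d (a , b)
  peeled-positive⇒disjoint {_} {a} {b} d∈ 0<h same with peeled-cases a b | same
  ... | inj₁ ≤0            | _                   = ℤ.<⇒≱ 0<h ≤0
  ... | inj₂ (¬ab , _ , _) | inj₁ (refl , refl) = ¬ab d∈
  ... | inj₂ (_ , ¬ba , _) | inj₂ (refl , refl) = ¬ba d∈

SameEdge-sym : {d e : Fin n × Fin n} → SameEdge d e → SameEdge e d
SameEdge-sym (inj₁ (refl , refl)) = inj₁ (refl , refl)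
SameEdge-sym (inj₂ (refl , refl)) = inj₂ (refl , refl)

-- Induction on `m`, peeling off one path at a time. The claim that the paths use only positive arcs
-- strengthens the induction: it makes the later paths disjoint from the one just removed.
decompose : (H : Graph n) {x y : Fin n} → x ≢ y → ∀ m {g} → SkewFlow H x y m g →
            Σ[ P ∈ EdgeDisjointPaths H x y m ]
              (∀ i {a b} → (a , b) List.∈ arcs (proj₁ P i) → 0ℤ <ℤ g a b)
decompose H x≢y zero F = ((λ ()) , λ ()) , λ ()
decompose {n} H {x} {y} x≢y (suc m) {g} F
  with path-or-cut H (λ a b → 0ℤ <ℤ? g a b) (positive⇒Adj F) x
... | inj₂ (X , x∈X , y∉X , blocked) = contradiction none λ { (+≤+ ()) }
  where
  -- With no positive path, nothing positive leaves `X`, yet the whole value `suc m` must cross it.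
  none : + suc m ≤ℤ 0ℤ
  none = ℤ.≤-trans (ℤ.≤-reflexive (sym (flow-across F x∈X y∉X)))
    (ℤ.≤-trans (crossing-mono X {h = λ _ _ → 0ℤ} λ a b a∈X b∉X → ℤ.≮⇒≥ (blocked a b a∈X b∉X))
               (ℤ.≤-reflexive (∑-zero {n} _ λ a → ∑-zero {n} _ λ b → ℤ.*-zeroʳ (𝟙 X a * 𝟙 (∁ X) b))))
... | inj₁ (p , positive) with decompose H x≢y m (Peel.peeled-flow F p positive)
...   | (ps , disjoint) , ps-positive = (paths , paths-disjoint) , paths-positive
  where
  open Peel F p positive

  paths : Fin (suc m) → Path H x y
  paths Fin.zero    = p
  paths (Fin.suc i) = ps i

  paths-disjoint : ∀ i j → i ≢ j → EdgeDisjoint (paths i) (paths j)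
  paths-disjoint Fin.zero    Fin.zero    0≢0 = contradiction refl 0≢0
  paths-disjoint Fin.zero    (Fin.suc j) _ d∈ e∈ = peeled-positive⇒disjoint d∈ (ps-positive j e∈)
  paths-disjoint (Fin.suc i) Fin.zero    _ d∈ e∈ =
    peeled-positive⇒disjoint e∈ (ps-positive i d∈) ∘ SameEdge-sym
  paths-disjoint (Fin.suc i) (Fin.suc j) i≢j = disjoint i j (i≢j ∘ cong Fin.suc)

  paths-positive : ∀ i {a b} → (a , b) List.∈ arcs (paths i) → 0ℤ <ℤ g a b
  paths-positive Fin.zero    ab = All.lookup positive ab
  paths-positive (Fin.suc i) ab = peeled-positive⇒ (ps-positive i ab)

-- The flow is the sum of the unit path flows. Two disjoint paths cannot both use the arc `(a , b)`,
-- so `∑-exclusive` gives the capacity bound.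
paths⇒flow : {H : Graph n} → EdgeDisjointPaths H x y m →
             ∃[ g ] SkewFlow H x y m g
paths⇒flow {n} {x} {y} {m} {H} (ps , disjoint) = total ps , record
  { skew   = total-skew ps
  ; bound  = total-bound
  ; supply = total-supply ps
  }
  where
  total : ∀ {l} → (Fin l → Path H x y) → Fin n → Fin n → ℤ
  total {l} qs a b = ∑[ i < l ] pathFlow (qs i) a b

  total-skew : ∀ {l} (qs : Fin l → Path H x y) → Skew (total qs)
  total-skew qs a b = trans (sum-cong-≗ λ i → pathFlow-skew (qs i) a b)
                            (∑-neg λ i → pathFlow (qs i) b a)

  total-supply : ∀ {l} (qs : Fin l → Path H x y) a →
                 excess (total qs) a ≡ + l * (ι (x ≟ a) - ι (y ≟ a))
  total-supply {zero}  qs a = ∑-zero {n} _ λ _ → refl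
  total-supply {suc l} qs a = trans
    (∑-distrib-+ (pathFlow (qs Fin.zero) a) (total (qs ∘ Fin.suc) a))
    (trans (cong₂ _+_ (pathFlow-excess (qs Fin.zero) a) (total-supply (qs ∘ Fin.suc) a))
           (sym (ℤ.suc-* (+ l) (ι (x ≟ a) - ι (y ≟ a)))))

  path-bound : ∀ (p : Path H x y) a b →
    pathFlow p a b ≤ℤ 0ℤ ⊎
    ((a , b) List.∈ arcs p × pathFlow p a b ≡ 1ℤ)
  path-bound p a b with onPath p a b
  ... | forward ab eq = inj₂ (ab , eq)
  ... | backward _ eq = inj₁ (ℤ.≤-trans (ℤ.≤-reflexive eq) -≤+)
  ... | off _ _ eq    = inj₁ (ℤ.≤-reflexive eq)

  total-bound : ∀ a b → total ps a b ≤ℤ + capacity H a b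
  total-bound a b = ∑-exclusive (+≤+ z≤n) (λ i → pathFlow (ps i) a b) each exclusive
    where
    each : ∀ i → pathFlow (ps i) a b ≤ℤ + capacity H a b
    each i with path-bound (ps i) a b
    ... | inj₁ ≤0        = ℤ.≤-trans ≤0 (+≤+ z≤n)
    ... | inj₂ (ab , eq) = ℤ.≤-reflexive
      (trans eq (cong +_ (sym (capacity-yes H (arc⇒Adj (ps i) ab)))))

    exclusive : ∀ i j → i ≢ j → pathFlow (ps i) a b ≤ℤ 0ℤ ⊎ pathFlow (ps j) a b ≤ℤ 0ℤ
    exclusive i j i≢j with path-bound (ps i) a b | path-bound (ps j) a b
    ... | inj₁ ≤0       | _             = inj₁ ≤0
    ... | inj₂ _        | inj₁ ≤0       = inj₂ ≤0
    ... | inj₂ (ab , _) | inj₂ (ab′ , _) =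
      contradiction (inj₁ (refl , refl)) (disjoint i j i≢j ab ab′)

-- Augmenting paths and minimum cuts

SeparatingCut : Graph n → Fin n → Fin n → ℕ → Set
SeparatingCut H x y m = ∃[ X ] (x ∈ X × y ∉ X × cut H X ≤ℤ + m)

-- The Ford-Fulkerson method with at most `N` augmentations. When no augmenting path exists, every
-- arc leaving `X` is saturated, so the cut is no larger than the current value.
flow-or-cut : (H : Graph n) (x y : Fin n) → ∀ N →
  (∃[ g ] SkewFlow H x y N g) ⊎ ∃[ m ] ((∃[ g ] SkewFlow H x y m g) × SeparatingCut H x y m)
flow-or-cut {n} H x y zero = inj₁ ((λ _ _ → 0ℤ) , record
  { skew   = λ _ _ → refl
  ; bound  = λ _ _ → +≤+ z≤n
  ; supply = λ _ → ∑-zero {n} _ λ _ → refl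
  })
flow-or-cut H x y (suc N) with flow-or-cut H x y N
... | inj₂ found = inj₂ found
... | inj₁ (g , F) with path-or-cut H (λ a b → g a b <ℤ? + capacity H a b) (unsaturated⇒Adj F) x
...   | inj₁ (p , unsaturated) = inj₁ (_ , augment F p unsaturated)
...   | inj₂ (X , x∈X , y∉X , saturated) = inj₂ (N , (g , F) , X , x∈X , y∉X , cut≤N)
  where
  cut≤N : cut H X ≤ℤ + N
  cut≤N = ℤ.≤-trans (crossing-mono X λ a b a∈X b∉X → ℤ.≮⇒≥ (saturated a b a∈X b∉X))
                    (ℤ.≤-reflexive (flow-across F x∈X y∉X))

-- The flow at which augmentation stops decomposes into `m` paths, and the cut found with it bounds
-- every other family by weak duality.
menger : (H : Graph n) → x ≢ y → ∃[ m ] (IsLocalConnectivity H x y m × SeparatingCut H x y m)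
-- The target exceeds the cut around `x` by one, so it cannot be reached and the search must end
-- with a cut.
menger {x = x} {y} H x≢y with flow-or-cut H x y (suc ∣ cut H ⁅ x ⁆ ∣)
... | inj₁ (g , F) = contradiction (flow≤cut F (x∈⁅x⁆ x) (x≢y ∘ sym ∘ x∈⁅y⁆⇒x≡y x)) (ℤ.<⇒≱ (below _))
  where
  below : ∀ i → i <ℤ + suc ∣ i ∣
  below (+ i)    = +<+ ℕ.≤-refl
  below -[1+ i ] = -<+
... | inj₂ (m , (g , F) , X , x∈X , y∉X , cut≤m) =
  m , (proj₁ (decompose H x≢y m F) , maximal) , X , x∈X , y∉X , cut≤m
  where
  maximal : ∀ m′ → EdgeDisjointPaths H x y m′ → m′ ≤ m
  maximal m′ P = ℤ.drop‿+≤+ (ℤ.≤-trans (flow≤cut (proj₂ (paths⇒flow P)) x∈X y∉X) cut≤m)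

-- Edge connectivity and cuts

-- The vertices `x` and `y` witness that `X` is nonempty and proper.
CutsAtLeast : ℕ → Graph n → Set
CutsAtLeast {n} k H = ∀ (X : Subset n) {x y} → x ∈ X → y ∉ X → + k ≤ℤ cut H X

-- The minimum ranges over values already known to be local connectivities; `menger` supplies one
-- for `x` and `y`, and its paths form a flow through the cut.
EdgeConnected⇒CutsAtLeast : ∀ {k} (H : Graph n) → EdgeConnected k H → CutsAtLeast k H
EdgeConnected⇒CutsAtLeast H (ℓ , (_ , minimal) , k≤ℓ) X {x} {y} x∈X y∉X
  with m , local , _ ← menger {x = x} {y} H (λ { refl → y∉X x∈X }) =
  ℤ.≤-trans (+≤+ (ℕ.≤-trans k≤ℓ (minimal x y m (λ { refl → y∉X x∈X }) local)))
            (flow≤cut (proj₂ (paths⇒flow (proj₁ local))) x∈X y∉X)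

-- The edge-connectivity must be exhibited as an attained minimum: it is found by `argmin` over all
-- distinct pairs, with `(u , v)` as the initial candidate.
CutsAtLeast⇒EdgeConnected : ∀ {k} (H : Graph n) {u v : Fin n} → u ≢ v →
                            CutsAtLeast k H → EdgeConnected k H
CutsAtLeast⇒EdgeConnected {n} {k} H {u} {v} u≢v k≤cuts =
  loc best ,
  ((proj₁ best , proj₂ best , best-distinct , proj₁ (loc-correct best best-distinct)) , minimal) ,
  k≤loc (loc-correct best best-distinct)
  where
  loc : Fin n × Fin n → ℕ
  loc (x , y) with x ≟ y
  -- A placeholder on the diagonal; only pairs of distinct vertices compete in `argmin`.
  ... | yes _  = 0
  ... | no x≢y = proj₁ (menger H x≢y)

  loc-correct : ∀ e → let x , y = e in x ≢ y →
                IsLocalConnectivity H x y (loc e) × SeparatingCut H x y (loc e)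
  loc-correct (x , y) x≢y with x ≟ y
  ... | yes x≡y = contradiction x≡y x≢y
  ... | no x≢y′ = proj₂ (menger H x≢y′)

  distinct? : (e : Fin n × Fin n) → Dec (proj₁ e ≢ proj₂ e)
  distinct? (x , y) = ¬? (x ≟ y)

  pairs : List (Fin n × Fin n)
  pairs = filter distinct? (cartesianProduct (allFin n) (allFin n))

  best : Fin n × Fin n
  best = argmin loc (u , v) pairs

  best-distinct : proj₁ best ≢ proj₂ best
  best-distinct = argmin-all loc {xs = pairs} {P = λ e → proj₁ e ≢ proj₂ e} u≢v
    (All.tabulate λ e∈ → proj₂ (∈-filter⁻ distinct? {xs = cartesianProduct (allFin n) (allFin n)} e∈))

  minimal : ∀ x y m → x ≢ y → IsLocalConnectivity H x y m → loc best ≤ m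
  minimal x y m x≢y (_ , maximal) = ℕ.≤-trans
    (All.lookup (f[argmin]≤f[xs] {f = loc} (u , v) pairs)
                (∈-filter⁺ distinct? (∈-cartesianProduct⁺ (∈-allFin x) (∈-allFin y)) x≢y))
    (maximal (loc (x , y)) (proj₁ (proj₁ (loc-correct (x , y) x≢y))))

  k≤loc : ∀ {x y m} → IsLocalConnectivity H x y m × SeparatingCut H x y m → k ≤ m
  k≤loc (_ , X , x∈X , y∉X , cut≤m) = ℤ.drop‿+≤+ (ℤ.≤-trans (k≤cuts X x∈X y∉X) cut≤m)

-- Effect of insertion and deletion on cuts

cut-∁ : (H : Graph n) (X : Subset n) → cut H (∁ X) ≡ cut H X
cut-∁ H X = crossing-∁ X λ a b → cong +_ (capacity-sym H a b)

_⊑_ : Graph n → Graph n → Set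
H ⊑ K = ∀ {a b} → Adj H a b → Adj K a b

cut-mono : (H K : Graph n) → H ⊑ K → ∀ X → cut H X ≤ℤ cut K X
cut-mono H K H⊑K X = crossing-mono X λ a b _ _ → +≤+ (capacity-mono H K H⊑K)

insert-⊑ : (H : Graph n) {u v : Fin n} (new : NonEdge H u v) → H ⊑ insert H u v new
insert-⊑ H new = inj₁

cut-insert : (H : Graph n) {s t : Fin n} (new : NonEdge H s t) → ∀ {X} → s ∈ X → t ∉ X →
             1ℤ + cut H X ≤ℤ cut (insert H s t new) X
cut-insert H {s} {t} new {X} s∈X t∉X =
  ℤ.≤-trans (ℤ.≤-reflexive (sym (crossing-add-arc X (λ a b → + capacity H a b) s∈X t∉X)))
            (crossing-mono X λ a b _ _ → pointwise a b)
  where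
  K : Graph _
  K = insert H s t new
  pointwise : ∀ a b → ι (s ≟ a) * ι (t ≟ b) + + capacity H a b ≤ℤ + capacity K a b
  pointwise a b with (s ≟ a) ×-dec (t ≟ b)
  ... | yes (refl , refl) = ℤ.≤-reflexive
    -- Since `s` and `t` were not adjacent, the old capacity is 0 and the new edge really adds one.
    (trans (cong₂ _+_ (ι*ι-yes (s ≟ s) (t ≟ t) refl refl)
                      (cong +_ (capacity-no H (proj₂ new))))
           (cong +_ (sym (capacity-yes K (inj₂ (inj₁ (refl , refl)))))))
  ... | no ¬st = ℤ.≤-trans
    (ℤ.≤-reflexive (trans (cong (_+ + capacity H a b) (ι*ι-no (s ≟ a) (t ≟ b) ¬st))
                          (ℤ.+-identityˡ (+ capacity H a b))))
    (+≤+ (capacity-mono H K inj₁))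

module _ (G : Graph n) (u v : Fin n) {X : Subset n} where

  -- Of the two deleted arcs only the one from `u` to `v` leaves `X`.
  cut-delete-separated : u ∈ X → v ∉ X → cut G X ≤ℤ 1ℤ + cut (delete G u v) X
  cut-delete-separated u∈X v∉X =
    ℤ.≤-trans (crossing-mono X pointwise)
              (ℤ.≤-reflexive (crossing-add-arc X (λ a b → + capacity G′ a b) u∈X v∉X))
    where
    G′ : Graph n
    G′ = delete G u v
    pointwise : ∀ a b → a ∈ X → b ∉ X →
                + capacity G a b ≤ℤ ι (u ≟ a) * ι (v ≟ b) + + capacity G′ a b
    pointwise a b a∈X b∉X = by-cases (sameEdge? (a , b) (u , v))
      where
      by-cases : Dec (SameEdge (a , b) (u , v)) →
                 + capacity G a b ≤ℤ ι (u ≟ a) * ι (v ≟ b) + + capacity G′ a b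
      by-cases (yes (inj₁ (refl , refl))) = ℤ.≤-trans (+≤+ (capacity≤1 G a b))
        (subst (λ z → 1ℤ ≤ℤ z + + capacity G′ a b) (sym (ι*ι-yes (a ≟ a) (b ≟ b) refl refl))
               (+≤+ (s≤s z≤n)))
      by-cases (yes (inj₂ (refl , refl))) = contradiction a∈X v∉X
      by-cases (no ¬uv) = ℤ.≤-trans (+≤+ (capacity-mono G G′ λ ab → ab , ¬uv))
        (ℤ.≤-trans (ℤ.≤-reflexive (sym (ℤ.+-identityˡ (+ capacity G′ a b))))
                   (ℤ.+-monoˡ-≤ (+ capacity G′ a b) (ι*ι-nonneg (u ≟ a) (v ≟ b))))

  -- The two implications put `u` and `v` on the same side, so the deleted edge does not cross.
  cut-delete-unseparated : (u ∈ X → v ∈ X) → (v ∈ X → u ∈ X) → cut G X ≤ℤ cut (delete G u v) X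
  cut-delete-unseparated u⇒v v⇒u = crossing-mono X λ a b a∈X b∉X →
    +≤+ (capacity-mono G (delete G u v) λ ab → ab ,
      λ { (inj₁ (refl , refl)) → b∉X (u⇒v a∈X) ; (inj₂ (refl , refl)) → b∉X (v⇒u a∈X) })

-- Only cuts separating u from v lose an edge when {u , v} is deleted.
restore : ∀ {k} (G : Graph n) (u v : Fin n) (K : Graph n) → CutsAtLeast k G → delete G u v ⊑ K →
          (∀ X → u ∈ X → v ∉ X → + k ≤ℤ cut K X) → CutsAtLeast k K
restore {k = k} G u v K k≤cuts G′⊑K separated X x∈X y∉X with u ∈? X | v ∈? X
... | yes u∈X | no v∉X  = separated X u∈X v∉X
... | no u∉X  | yes v∈X = subst (+ k ≤ℤ_) (cut-∁ K X)
  (separated (∁ X) (x∉p⇒x∈∁p u∉X) (x∈p⇒x∉∁p v∈X))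
... | yes u∈X | yes v∈X = ℤ.≤-trans (k≤cuts X x∈X y∉X)
  (ℤ.≤-trans (cut-delete-unseparated G u v (λ _ → v∈X) (λ _ → u∈X))
             (cut-mono (delete G u v) K G′⊑K X))
... | no u∉X  | no v∉X  = ℤ.≤-trans (k≤cuts X x∈X y∉X)
  (ℤ.≤-trans (cut-delete-unseparated G u v (λ u∈X → contradiction u∈X u∉X)
                                           (λ v∈X → contradiction v∈X v∉X))
             (cut-mono (delete G u v) K G′⊑K X))

-- Saturation of cuts by the given flow

module _ {H : Graph n} {u v : Fin n} {f : Fin n → Fin n → ℕ} (F : IsFlow H u v f) where
  open IsFlow F

  -- `f` may use both arcs of an edge; passing to the difference makes it skew, as the results on
  -- `crossing` require.
  net : Fin n → Fin n → ℤ
  net a b = + f a b - + f b a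

  net-skew : Skew net
  net-skew a b = swap (+ f a b) (+ f b a)
    where
    swap : ∀ i j → i - j ≡ - (j - i)
    swap = solve-∀

  net≤capacity : ∀ a b → net a b ≤ℤ + capacity H a b
  net≤capacity a b = ℤ.i≤j⇒i-k≤j (+ f b a) (+≤+ (bounded a b))

  net-excess : ∀ a → excess net a ≡ + outflow f a - + inflow f a
  net-excess a = trans (∑-distrib-+ (λ b → + f a b) (λ b → - + f b a))
    (cong₂ _+_ (∑-pos (f a)) (trans (∑-neg λ b → + f b a) (cong -_ (∑-pos λ b → f b a))))
    where
    ∑-pos : ∀ {l} (h : Fin l → ℕ) → sum (λ i → + h i) ≡ + ℕ∑.sum h
    ∑-pos {zero}  h = refl
    ∑-pos {suc l} h = trans (cong (λ z → + h Fin.zero + z) (∑-pos (h ∘ Fin.suc)))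
                            (sym (ℤ.pos-+ (h Fin.zero) _))

  value-across : ∀ {X} → u ∈ X → v ∉ X → crossing X net ≡ value f u
  value-across {X} u∈X v∉X = trans
    (excess-across X net-skew u∈X v∉X λ a a≢u a≢v → trans (net-excess a)
      (trans (cong (λ o → + o - + inflow f a) (conserved a a≢u a≢v)) (ℤ.+-inverseʳ (+ inflow f a))))
    (trans (net-excess u) (ℤ.[+m]-[+n]≡m⊖n (outflow f u) (inflow f u)))

  value≤cut : ∀ {X} → u ∈ X → v ∉ X → value f u ≤ℤ cut H X
  value≤cut {X} u∈X v∉X = ℤ.≤-trans (ℤ.≤-reflexive (sym (value-across u∈X v∉X)))
                                    (crossing-mono X λ a b _ _ → net≤capacity a b)

  module _ {X : Subset n} (u∈X : u ∈ X) (v∉X : v ∉ X) (saturated : cut H X ≤ℤ value f u) where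

    -- The net flow across the cut equals its size, so `crossing-tight` gives `capacity H a b + f b
    -- a ≤ f a b ≤ capacity H a b`. Hence `f b a` is 0 and `f a b` fills the arc: both summands of
    -- the residual capacity vanish.
    no-residual-arc : ∀ {a b} → a ∈ X → b ∉ X → ¬ ResidualArc H f a b
    no-residual-arc {a} {b} a∈X b∉X 0<r = ℕ.<⇒≱ 0<r (ℕ.≤-reflexive residual≡0)
      where
      c+f≤f : capacity H a b ℕ.+ f b a ≤ f a b
      c+f≤f = ℤ.drop‿+≤+ (≤-sub⇒+-≤ (crossing-tight X (λ a b _ _ → net≤capacity a b)
        (ℤ.≤-trans saturated (ℤ.≤-reflexive (sym (value-across u∈X v∉X)))) a b a∈X b∉X))
        where
        sub-add : ∀ i j → i - j + j ≡ i
        sub-add = solve-∀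
        ≤-sub⇒+-≤ : + capacity H a b ≤ℤ + f a b - + f b a →
                    + capacity H a b + + f b a ≤ℤ + f a b
        ≤-sub⇒+-≤ c≤ = ℤ.≤-trans (ℤ.+-monoˡ-≤ (+ f b a) c≤)
                                 (ℤ.≤-reflexive (sub-add (+ f a b) (+ f b a)))
      residual≡0 : residual H f a b ≡ 0
      residual≡0 = cong₂ ℕ._+_
        (ℕ.m≤n⇒m∸n≡0 (ℕ.≤-trans (ℕ.m≤m+n _ (f b a)) c+f≤f))
        (ℕ.n≤0⇒n≡0 (ℕ.+-cancelˡ-≤ (capacity H a b) _ _
          (ℕ.≤-trans c+f≤f (ℕ.≤-trans (bounded a b) (ℕ.≤-reflexive (sym (ℕ.+-identityʳ _)))))))

    residual-closed : ∀ {a b} → Star (ResidualArc H f) a b → a ∈ X → b ∈ X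
    residual-closed ε a∈X = a∈X
    residual-closed (_◅_ {j = c} ac w) a∈X with c ∈? X
    ... | yes c∈X = residual-closed w c∈X
    ... | no c∉X  = contradiction ac (no-residual-arc a∈X c∉X)

-- Counting new edges

-- Pigeonhole: of any three entries, two take the same one of the values `c` and `d`.
Unique-pair-length : {A : Set} {c d : A} {es : List A} → All (λ e → e ≡ c ⊎ e ≡ d) es →
                     Unique es → length es ≤ 2
Unique-pair-length {es = []}         _ _ = z≤n
Unique-pair-length {es = _ ∷ []}     _ _ = s≤s z≤n
Unique-pair-length {es = _ ∷ _ ∷ []} _ _ = s≤s (s≤s z≤n)
Unique-pair-length {es = _ ∷ _ ∷ _ ∷ _} (e₁ ∷ e₂ ∷ e₃ ∷ _) ((e₁≢e₂ ∷ e₁≢e₃ ∷ _) ∷ (e₂≢e₃ ∷ _) ∷ _)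
  with e₁ | e₂ | e₃
... | inj₁ refl | inj₁ refl | _         = contradiction refl e₁≢e₂
... | inj₂ refl | inj₂ refl | _         = contradiction refl e₁≢e₂
... | inj₁ refl | inj₂ _    | inj₁ refl = contradiction refl e₁≢e₃
... | inj₂ refl | inj₁ _    | inj₂ refl = contradiction refl e₁≢e₃
... | inj₁ _    | inj₂ refl | inj₂ refl = contradiction refl e₂≢e₃
... | inj₂ _    | inj₁ refl | inj₁ refl = contradiction refl e₂≢e₃

-- For distinct ends, the ordered pair by which `E` represents the edge.
orient : Fin n × Fin n → Fin n × Fin n
orient (x , y) with x Finₚ.<? y
... | yes _ = x , y
... | no _  = y , x

SameEdge⇒≡orient : {a b : Fin n} {e : Fin n × Fin n} → a Fin.< b → SameEdge (a , b) e →
                   (a , b) ≡ orient e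
SameEdge⇒≡orient {a = a} {b} a<b (inj₁ (refl , refl)) with a Finₚ.<? b
... | yes _  = refl
... | no a≮b = contradiction a<b a≮b
SameEdge⇒≡orient {a = a} {b} a<b (inj₂ (refl , refl)) with b Finₚ.<? a
... | yes b<a = contradiction b<a (ℕ.<-asym a<b)
... | no _    = refl

module _ (H : Graph n) where

  listed? : (e : Fin n × Fin n) → Dec (proj₁ e Fin.< proj₂ e × Adj H (proj₁ e) (proj₂ e))
  listed? e = (proj₁ e Finₚ.<? proj₂ e) ×-dec Adj? H (proj₁ e) (proj₂ e)

  ∈E⁺ : ∀ {a b} → a Fin.< b → Adj H a b → (a , b) List.∈ E H
  ∈E⁺ a<b ab = ∈-filter⁺ listed? (∈-cartesianProduct⁺ (∈-allFin _) (∈-allFin _)) (a<b , ab)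

  ∈E⁻ : ∀ {a b} → (a , b) List.∈ E H → a Fin.< b × Adj H a b
  ∈E⁻ ab∈ = proj₂ (∈-filter⁻ listed? {xs = cartesianProduct (allFin n) (allFin n)} ab∈)

  E-unique : Unique (E H)
  E-unique = Unique.filter⁺ listed? (Unique.cartesianProduct⁺ (Unique.allFin⁺ n) (Unique.allFin⁺ n))

-- `e₁` and `e₂` may coincide; a single inserted edge is passed twice.
new-edges≤2 : (K H : Graph n) (e₁ e₂ : Fin n × Fin n) →
  (∀ {a b} → Adj K a b → ¬ Adj H a b → SameEdge (a , b) e₁ ⊎ SameEdge (a , b) e₂) →
  length (E K ∖ E H) ≤ 2
new-edges≤2 K H e₁ e₂ new = Unique-pair-length {c = orient e₁} {orient e₂}
  (All.tabulate λ e∈ → classify (∈-filter⁻ old? {xs = E K} e∈))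
  (Unique.filter⁺ old? (E-unique K))
  where
  old? : ∀ e → Dec (¬ (e List.∈ E H))
  old? e = ¬? (DecMembership._∈?_ (≡-dec _≟_ _≟_) e (E H))
  classify : ∀ {e} → e List.∈ E K × ¬ e List.∈ E H → e ≡ orient e₁ ⊎ e ≡ orient e₂
  classify (e∈K , e∉H) with a<b , ab ← ∈E⁻ K e∈K with new ab (e∉H ∘ ∈E⁺ H a<b)
  ... | inj₁ same = inj₁ (SameEdge⇒≡orient a<b same)
  ... | inj₂ same = inj₂ (SameEdge⇒≡orient a<b same)

-- Correctness of the augmentation procedure

theorem7 : ∀ {n : ℕ} (k : ℕ) → 1 ≤ k →
    (G : Graph n) → EdgeConnected k G →
    (u v : Fin n) → Adj G u v →
    (∃[ ℓ ] (IsEdgeConnectivity (delete G u v) ℓ × ℓ < k)) →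
    (G″ : Graph n) → HandleDeletion k G u v G″ →
    EdgeConnected k G″ × (length (E G″ ∖ E (delete G u v)) ≤ 2)
theorem7 {n} k _ G G-connected u v uv _ = handle
  where
  G′ : Graph n
  G′ = delete G u v

  k≤cuts : CutsAtLeast k G
  k≤cuts = EdgeConnected⇒CutsAtLeast G G-connected

  connected : (K : Graph n) → G′ ⊑ K → (∀ X → u ∈ X → v ∉ X → + k ≤ℤ cut K X) → EdgeConnected k K
  connected K G′⊑K separated = CutsAtLeast⇒EdgeConnected K (λ u≡v → Adj-irrefl G u≡v uv)
    (restore G u v K k≤cuts G′⊑K separated)

  k≤1+cut : ∀ X → u ∈ X → v ∉ X → + k ≤ℤ 1ℤ + cut G′ X
  k≤1+cut X u∈X v∉X = ℤ.≤-trans (k≤cuts X u∈X v∉X) (cut-delete-separated G u v u∈X v∉X)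

  handle : (G″ : Graph n) → HandleDeletion k G u v G″ →
           EdgeConnected k G″ × length (E G″ ∖ E G′) ≤ 2
  handle _ (unchanged f (F , _) k≤value) =
    -- By weak duality a flow of value at least `k` forces every cut separating `u` from `v` to have
    -- at least `k` edges.
    connected G′ (λ ab → ab) (λ X u∈X v∉X → ℤ.≤-trans k≤value (value≤cut F u∈X v∉X)) ,
    new-edges≤2 G′ G′ (u , v) (u , v) λ ab ¬ab → contradiction ab ¬ab
  handle G″ (addOne f (F , _) value≡ S S-reach T T-reach _ u′ v′ u′∈S v′∈T _ new) =
    connected G″ (insert-⊑ G′ new) separated ,
    new-edges≤2 G″ G′ (u′ , v′) (u′ , v′)
      λ { (inj₁ ab) ¬ab → contradiction ab ¬ab ; (inj₂ same) _ → inj₁ same }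
    where
    separated : ∀ X → u ∈ X → v ∉ X → + k ≤ℤ cut G″ X
    separated X u∈X v∉X with + k ≤ℤ? cut G′ X
    ... | yes k≤cut = ℤ.≤-trans k≤cut (cut-mono G′ G″ (insert-⊑ G′ new) X)
    ... | no k≰cut  = ℤ.≤-trans (k≤1+cut X u∈X v∉X) (cut-insert G′ new u′∈X v′∉X)
      where
      -- A cut below `k` has at most `k - 1` edges, which is exactly the value of `f`.
      saturated : cut G′ X ≤ℤ value f u
      saturated = ℤ.≤-trans (ℤ.i<j⇒i≤pred[j] (ℤ.≰⇒> k≰cut))
        (ℤ.≤-reflexive (trans (ℤ.+-comm -1ℤ (+ k)) (sym value≡)))
      u′∈X : u′ ∈ X
      u′∈X = residual-closed F u∈X v∉X saturated (Equivalence.to (S-reach u′) u′∈S) u∈X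
      v′∉X : v′ ∉ X
      v′∉X v′∈X = v∉X (residual-closed F u∈X v∉X saturated (Equivalence.to (T-reach v′) v′∈T) v′∈X)
  handle G″ (addTwo f _ _ S _ T _ _ _ w _ _ new₁ new₂) =
    connected G″ (λ ab → inj₁ (inj₁ ab)) separated ,
    new-edges≤2 G″ G′ (u , w) (w , v)
      λ { (inj₁ (inj₁ ab)) ¬ab → contradiction ab ¬ab
        ; (inj₁ (inj₂ same)) _ → inj₁ same
        ; (inj₂ same) _        → inj₂ same }
    where
    H : Graph n
    H = insert G′ u w new₁
    separated : ∀ X → u ∈ X → v ∉ X → + k ≤ℤ cut G″ X
    -- The side of `w` decides which new edge crosses: `{w , v}` if `w` is in `X`, and `{u , w}`
    -- otherwise.
    separated X u∈X v∉X with w ∈? X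
    ... | yes w∈X = ℤ.≤-trans (k≤1+cut X u∈X v∉X)
      (ℤ.≤-trans (ℤ.+-monoʳ-≤ 1ℤ (cut-mono G′ H (insert-⊑ G′ new₁) X)) (cut-insert H new₂ w∈X v∉X))
    ... | no w∉X  = ℤ.≤-trans (k≤1+cut X u∈X v∉X)
      (ℤ.≤-trans (cut-insert G′ new₁ u∈X w∉X) (cut-mono H G″ (insert-⊑ H new₂) X))
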